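{- For each positive integer $m$ there is an integer $n_0$ such that for every odd integer $n \geq n_0$ there exists a perfect Latin rectangle of size $m \times n$.
   Context: Let $m\le n$ be positive integers. A Latin rectangle $R$ of size $m\times n$ is an $m\times n$ array filled with symbols from an alphabet $\Sigma_R$ of $n$ symbols such that each row contains every symbol of $\Sigma_R$ exactly once and each column contains $m$ distinct symbols; $R(a,c)$ denotes the symbol in row $a$, column $c$. For two rows $a,b$, the permutation $R_{a,b}$ of $\Sigma_R$ is defined by $R_{a,b}(x)=y$ iff there is a column $c$ with $R(a,c)=x$ and $R(b,c)=y$. The pair $(a,b)$ is perfect if $R_{a,b}$ is a cyclic permutation (a single cycle of length $n$), and $R$ is a perfect Latin rectangle if every pair of distinct rows is perfect. -}

module Defs where

open import Data.Nat using (ℕ; zero; suc)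
open import Data.Fin using (Fin)
open import Data.Product using (Σ; ∃; _×_; _,_)
open import Relation.Binary.PropositionalEquality using (_≡_)
open import Relation.Nullary using (¬_)
open import Function using (Bijective; Injective)

Array : ℕ → ℕ → Set
Array m n = Fin m → Fin n → Fin n

IsLatinRectangle : ∀ {m n} → Array m n → Set
IsLatinRectangle {m} {n} R =
  (∀ (a : Fin m) → Bijective _≡_ _≡_ (λ c → R a c)) ×
  (∀ (c : Fin n) → Injective _≡_ _≡_ (λ a → R a c))

-- The permutation R_{a,b} as its graph: R_{a,b}(x) = y iff some column c
-- has R(a,c) = x and R(b,c) = y.
RowPerm : ∀ {m n} → Array m n → Fin m → Fin m → Fin n → Fin n → Set
RowPerm {n = n} R a b x y = Σ (Fin n) λ c → (R a c ≡ x) × (R b c ≡ y)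

Iter : ∀ {n} → (Fin n → Fin n → Set) → ℕ → Fin n → Fin n → Set
Iter P zero x y = x ≡ y
Iter {n} P (suc k) x y = Σ (Fin n) λ z → P x z × Iter P k z y

-- A permutation of Fin n (given by its graph) is cyclic, i.e. a single
-- cycle of length n, iff every symbol lies in the orbit of every other.
IsCyclic : ∀ {n} → (Fin n → Fin n → Set) → Set
IsCyclic {n} P = ∀ (x y : Fin n) → Σ ℕ λ k → Iter P k x y

IsPerfectPair : ∀ {m n} → Array m n → Fin m → Fin m → Set
IsPerfectPair R a b = IsCyclic (RowPerm R a b)

IsPerfectLatinRectangle : ∀ {m n} → Array m n → Set
IsPerfectLatinRectangle {m} R =
  IsLatinRectangle R × (∀ (a b : Fin m) → ¬ (a ≡ b) → IsPerfectPair R a b)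

{-# OPTIONS --safe #-}

-- If σ is a cycle on A and τ a cycle on B, where A and B share exactly one
-- point, then στ is a single cycle on A ∪ B.  Since (σ_i τ_i)⁻¹ (σ_j τ_j) is
-- conjugate to (σ_i⁻¹ σ_j)(τ_j τ_i⁻¹), composing the rows of a perfect
-- m × (a + 1) rectangle with those of a perfect m × (b + 1) rectangle along
-- one shared point gives a perfect m × (a + b + 1) rectangle.
-- Shifts of ℤ/n by 0, …, m - 1 form a perfect rectangle as soon as every
-- e in {1, …, m - 1} is a unit mod n, which holds for n = E ± 1 whenever all
-- such e divide E.  Taking E = 4 m!, the sizes E - 1 and E + 1 contribute
-- a = E - 2 and a = E, whose sums cover all large even numbers.
module Submission where

open import Defs
open import Data.Fin using (Fin; zero; suc; toℕ; _≟_)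
open import Data.Fin.Properties
  using (fromℕ<-cong; fromℕ<-toℕ; toℕ-fromℕ<; toℕ<n; toℕ-injective; +↔⊎)
open import Data.Nat using (ℕ; zero; suc; _≤_; _<_; _*_; _+_; _∸_; _!; z≤n; s≤s; NonZero)
open import Data.Nat.DivMod
open import Data.Nat.Divisibility using (_∣_; divides; ∣-trans; m∣m*n; n∣m*n; m≤n⇒m!∣n!)
open import Data.Nat.Properties hiding (_≟_)
open import Data.Nat.Tactic.RingSolver using (solve-∀)
open import Data.Product using (Σ; ∃; _×_; _,_)
open import Data.Sum using (_⊎_; inj₁; inj₂)
open import Data.Sum.Function.Propositional using (_⊎-↔_)
open import Function using (_∘_; case_of_; _↔_; mk↔ₛ′; Inverse; Bijection; Injective)
open import Function.Properties.Inverse using (↔-refl; ↔-sym; ↔-trans; ↔⇒⤖)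
open import Relation.Binary.Construct.Closure.ReflexiveTransitive
  using (Star; ε; _◅_; _◅◅_; gmap; return; reverse; kleisliStar)
open import Relation.Binary.Definitions using (tri<; tri≈; tri>)
open import Relation.Binary.PropositionalEquality
open import Relation.Nullary using (¬_; yes; no; contradiction)

open Inverse using (to; from; strictlyInverseˡ)

-- Perfect rectangles as families of bijections.

private
  variable
    C C′ S S′ : Set

-- `RowPerm` with free types of columns and symbols, so that gluing can work on disjoint sums.
Step : (f g : C → S) → S → S → Set
Step {C} f g x y = Σ C λ c → f c ≡ x × g c ≡ y

Transitive : (f g : C → S) → Set
Transitive f g = ∀ x y → Star (Step f g) x y

Perfect : ℕ → Set → Set → Set
Perfect m C S = Σ (Fin m → C ↔ S) λ R →
  ∀ a b → ¬ (a ≡ b) → Transitive (to (R a)) (to (R b))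

Transitive-sym : {f g : C → S} → Transitive f g → Transitive g f
Transitive-sym t x y = reverse (λ { (c , p , q) → c , q , p }) (t y x)

Perfect-resp-↔ : ∀ {m} → C ↔ C′ → S ↔ S′ → Perfect m C S → Perfect m C′ S′
Perfect-resp-↔ {C} {C′} {S} {S′} γ δ (R , perfect) =
  (λ a → ↔-trans (↔-sym γ) (↔-trans (R a) δ)) ,
  λ a b a≢b x y →
    subst₂ (Star _) (strictlyInverseˡ δ x) (strictlyInverseˡ δ y)
      (gmap (to δ) (step a b) (perfect a b a≢b (from δ x) (from δ y)))
  where
  step : ∀ a b {x y} → Step (to (R a)) (to (R b)) x y →
         Step (to δ ∘ to (R a) ∘ from γ) (to δ ∘ to (R b) ∘ from γ) (to δ x) (to δ y)
  step a b (c , refl , refl) =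
    to γ c , cong (to δ ∘ to (R a)) back , cong (to δ ∘ to (R b)) back
    where back = Inverse.strictlyInverseʳ γ c

-- Gluing along a common point

moveZero : ∀ {p q} → (Fin p ⊎ Fin (suc q)) ↔ (Fin (suc p) ⊎ Fin q)
moveZero = mk↔ₛ′
  (λ { (inj₁ i) → inj₁ (suc i) ; (inj₂ zero) → inj₁ zero ; (inj₂ (suc j)) → inj₂ j })
  (λ { (inj₁ zero) → inj₂ zero ; (inj₁ (suc i)) → inj₁ i ; (inj₂ j) → inj₂ (suc j) })
  (λ { (inj₁ zero) → refl ; (inj₁ (suc i)) → refl ; (inj₂ j) → refl })
  (λ { (inj₁ i) → refl ; (inj₂ zero) → refl ; (inj₂ (suc j)) → refl })

-- The shared point is the column zero of σ and the symbol zero of τ.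
glueRow : ∀ {p q} → Fin (suc p) ↔ S → C ↔ Fin (suc q) → (Fin p ⊎ C) ↔ (S ⊎ Fin q)
glueRow σ τ = ↔-trans (↔-refl ⊎-↔ τ) (↔-trans moveZero (σ ⊎-↔ ↔-refl))

module _ {p q : ℕ} (σ σ′ : Fin (suc p) ↔ S) (τ τ′ : C ↔ Fin (suc q))
         (σ-transitive : Transitive (to σ) (to σ′))
         (τ-transitive : Transitive (to τ) (to τ′)) where

  private
    _⟶_ _⟶*_ : S ⊎ Fin q → S ⊎ Fin q → Set
    _⟶_ = Step (to (glueRow σ τ)) (to (glueRow σ′ τ′))
    _⟶*_ = Star _⟶_

    -- Places the symbols of τ among the glued ones. Only the image of the shared point depends on
    -- the row ρ.
    attach : Fin (suc p) ↔ S → Fin (suc q) → S ⊎ Fin q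
    attach ρ zero    = inj₁ (to ρ zero)
    attach ρ (suc j) = inj₂ j

    glueRow-inj₂ : ∀ ρ (υ : C ↔ Fin (suc q)) c →
                   to (glueRow ρ υ) (inj₂ c) ≡ attach ρ (to υ c)
    glueRow-inj₂ ρ υ c with to υ c
    ... | zero  = refl
    ... | suc j = refl

    τ-step : ∀ {w z} → Step (to τ) (to τ′) w z → attach σ w ⟶ attach σ′ z
    τ-step (c , refl , refl) = inj₂ c , glueRow-inj₂ σ τ c , glueRow-inj₂ σ′ τ′ c

    -- Away from the shared point `attach σ′` and `attach σ` agree, so each arrival is the next
    -- departure. The path is cut at its first visit to `zero`, where the two differ.
    excursion : ∀ {w z} → Star (Step (to τ) (to τ′)) w z → z ≡ zero →
                attach σ′ w ⟶* inj₁ (to σ′ zero)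
    excursion {zero}  _        _    = ε
    excursion {suc j} ε        ()
    excursion {suc j} (s ◅ ss) z≡0 = τ-step s ◅ excursion ss z≡0

    -- Column `zero` of σ is not among the columns `Fin p` kept from σ. A trip along the τ-cycle,
    -- from the shared point back to it, replaces its edge.
    detour : inj₁ (to σ zero) ⟶* inj₁ (to σ′ zero)
    detour = τ-step (from τ zero , strictlyInverseˡ τ zero , refl) ◅
             excursion (τ-transitive _ zero) refl

    σ-step : ∀ {x y} → Step (to σ) (to σ′) x y → inj₁ x ⟶* inj₁ y
    σ-step (zero  , refl , refl) = detour
    σ-step (suc i , refl , refl) = return (inj₁ i , refl , refl)

    inj₁-connected : ∀ x y → inj₁ x ⟶* inj₁ y
    inj₁-connected x y = kleisliStar inj₁ σ-step (σ-transitive x y)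

    τ-step* : ∀ {w z} → Step (to τ) (to τ′) w z → attach σ w ⟶* attach σ z
    -- A τ-step into the shared point lands on `to σ′ zero`; the symbols of σ are already connected,
    -- which leads on to `to σ zero`.
    τ-step* {z = zero}  s = τ-step s ◅ inj₁-connected _ _
    τ-step* {z = suc _} s = return (τ-step s)

    attach-connected : ∀ w z → attach σ w ⟶* attach σ z
    attach-connected w z = kleisliStar (attach σ) τ-step* (τ-transitive w z)

  glueRow-transitive : Transitive (to (glueRow σ τ)) (to (glueRow σ′ τ′))
  glueRow-transitive (inj₁ x) (inj₁ y) = inj₁-connected x y
  -- Mixed cases pass through `attach σ zero`, which is `inj₁ (to σ zero)`.
  glueRow-transitive (inj₁ x) (inj₂ j) = inj₁-connected x _ ◅◅ attach-connected zero (suc j)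
  glueRow-transitive (inj₂ i) (inj₁ y) = attach-connected (suc i) zero ◅◅ inj₁-connected _ y
  glueRow-transitive (inj₂ i) (inj₂ j) = attach-connected (suc i) (suc j)

PerfectSize : ℕ → ℕ → Set
PerfectSize m n = Perfect m (Fin n) (Fin n)

glue : ∀ {m p q} → PerfectSize m (suc p) → PerfectSize m (suc q) → PerfectSize m (suc (p + q))
glue {m} {p} {q} (R , R-perfect) (T , T-perfect) =
  Perfect-resp-↔
    (subst (λ n → (Fin p ⊎ Fin (suc q)) ↔ Fin n) (+-suc p q) (↔-sym +↔⊎))
    (↔-sym (+↔⊎ {suc p} {q}))
    ((λ a → glueRow (R a) (T a)) ,
     λ a b a≢b → glueRow-transitive (R a) (R b) (T a) (T b)
                   (R-perfect a b a≢b) (T-perfect a b a≢b))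

PerfectSize-1 : ∀ {m} → PerfectSize m 1
PerfectSize-1 = (λ _ → ↔-refl) , λ { _ _ _ zero zero → ε }

glue-replicate : ∀ {m p} k → PerfectSize m (suc p) → PerfectSize m (suc (k * p))
glue-replicate zero    P = PerfectSize-1
glue-replicate (suc k) P = glue P (glue-replicate k P)

-- Shifts of ℤ/n

module _ {n : ℕ} where

  private
    N : ℕ
    N = suc n

  mod-cong : ∀ s t → s % N ≡ t % N → s mod N ≡ t mod N
  mod-cong s t eq = fromℕ<-cong _ _ eq (m%n<n s N) (m%n<n t N)

  toℕ-mod : ∀ (x : Fin N) → toℕ x mod N ≡ x
  toℕ-mod x = trans (fromℕ<-cong _ _ (m<n⇒m%n≡m (toℕ<n x)) (m%n<n (toℕ x) N) (toℕ<n x))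
                    (fromℕ<-toℕ x (toℕ<n x))

  [m+kn]mod : ∀ t k → (t + k * N) mod N ≡ t mod N
  [m+kn]mod t k = mod-cong (t + k * N) t ([m+kn]%n≡m%n t k N)

  mod-+ : ∀ s a → (toℕ (s mod N) + a) mod N ≡ (s + a) mod N
  mod-+ s a = mod-cong (toℕ (s mod N) + a) (s + a) (begin
    (toℕ (s mod N) + a) % N    ≡⟨ cong (λ r → (r + a) % N) (toℕ-fromℕ< (m%n<n s N)) ⟩
    (s % N + a) % N            ≡⟨ %-distribˡ-+ (s % N) a N ⟩
    (s % N % N + a % N) % N    ≡⟨ cong (λ r → (r + a % N) % N) (m%n%n≡m%n s N) ⟩
    (s % N + a % N) % N        ≡⟨ %-distribˡ-+ s a N ⟨
    (s + a) % N                ∎)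
    where open ≡-Reasoning

  shift : ℕ → Fin N → Fin N
  shift a x = (toℕ x + a) mod N

  shift-+ : ∀ a b x → shift b (shift a x) ≡ shift (a + b) x
  shift-+ a b x = trans (mod-+ (toℕ x + a) b) (cong (_mod N) (+-assoc (toℕ x) a b))

  shift-multiple : ∀ k x → shift (k * N) x ≡ x
  shift-multiple k x = trans ([m+kn]mod (toℕ x) k) (toℕ-mod x)

  -- Since `n` is -1 modulo `N`, shifting by `n * a` undoes shifting by `a`.
  shift-↔ : ℕ → Fin N ↔ Fin N
  shift-↔ a = mk↔ₛ′ (shift a) (shift (n * a))
    (λ x → trans (shift-+ (n * a) a x)
      (trans (cong (λ t → shift t x) (lemma₁ n a)) (shift-multiple a x)))
    (λ x → trans (shift-+ a (n * a) x)
      (trans (cong (λ t → shift t x) (lemma₂ n a)) (shift-multiple a x)))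
    where
    lemma₁ : ∀ n a → n * a + a ≡ a * suc n
    lemma₁ = solve-∀
    lemma₂ : ∀ n a → a + n * a ≡ a * suc n
    lemma₂ = solve-∀

  module _ (a e : ℕ) where

    private
      _⟶*_ : ℕ → ℕ → Set
      s ⟶* t = Star (Step (shift a) (shift (a + e))) (s mod N) (t mod N)

    shift-step : ∀ s → s ⟶* (s + e)
    shift-step s = return
      -- The column s - a, with `n * a` standing for -a.
      ( (s + n * a) mod N
      , trans (mod-+ (s + n * a) a)
          (trans (cong (_mod N) (lemma₁ n s a)) ([m+kn]mod s a))
      , trans (mod-+ (s + n * a) (a + e))
          (trans (cong (_mod N) (lemma₂ n s a e)) ([m+kn]mod (s + e) a)))
      where
      lemma₁ : ∀ n s a → s + n * a + a ≡ s + a * suc n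
      lemma₁ = solve-∀
      lemma₂ : ∀ n s a e → s + n * a + (a + e) ≡ s + e + a * suc n
      lemma₂ = solve-∀

    shift-steps : ∀ j s → s ⟶* (s + j * e)
    shift-steps zero    s = subst (s ⟶*_) (sym (+-identityʳ s)) ε
    shift-steps (suc j) s =
      shift-step s ◅◅ subst ((s + e) ⟶*_) (+-assoc s e (j * e)) (shift-steps j (s + e))

    module _ (up : ∀ s → s ⟶* suc s) where

      climb : ∀ j s → s ⟶* (j + s)
      climb zero    s = ε
      climb (suc j) s = climb j s ◅◅ up (j + s)

      up⇒transitive : Transitive (shift a) (shift (a + e))
      up⇒transitive x y =
        subst₂ (Star _) (toℕ-mod x)
          (trans (cong (_mod N) (lemma n (toℕ x) (toℕ y)))
            (trans ([m+kn]mod (toℕ y) (toℕ x)) (toℕ-mod y)))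
          -- The number of ascents is y - x modulo `N`, kept a natural number.
          (climb (toℕ y + n * toℕ x) (toℕ x))
        where
        lemma : ∀ n s t → t + n * s + s ≡ t + s * suc n
        lemma = solve-∀

    -- Here `j` is the inverse of `e` modulo `N`, so `j` steps make one ascent.
    shift-transitive⁺ : ∀ j → j * e ≡ suc N → Transitive (shift a) (shift (a + e))
    shift-transitive⁺ j je≡1+N = up⇒transitive λ s →
      subst (Star _ (s mod N))
        (trans (cong (λ t → (s + t) mod N) je≡1+N)
          (trans (cong (_mod N) (lemma s n)) ([m+kn]mod (suc s) 1)))
        (shift-steps j s)
      where
      lemma : ∀ s n → s + suc (suc n) ≡ suc s + 1 * suc n
      lemma = solve-∀

    -- Here the steps descend by one; n descents amount to one ascent.
    shift-transitive⁻ : ∀ j → j * e ≡ n → Transitive (shift a) (shift (a + e))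
    shift-transitive⁻ j je≡n = up⇒transitive λ s →
      subst (Star _ (s mod N))
        (trans (cong (λ t → (s + t) mod N)
                 (trans (*-assoc n j e) (cong (n *_) je≡n)))
          (wrap s n refl))
        (shift-steps (n * j) s)
      where
      lemma : ∀ s k → s + suc k * suc k ≡ suc s + k * suc (suc k)
      lemma = solve-∀
      wrap : ∀ s k → k ≡ n → (s + n * n) mod N ≡ suc s mod N
      -- The identity n² = 1 + (n - 1)(n + 1) needs a predecessor of `n`; for n = 0 the modulus is
      -- 1.
      wrap s zero    refl = sym (trans (cong (_mod N) (+-comm 1 s))
                              (trans ([m+kn]mod s 1) (cong (_mod N) (sym (+-identityʳ s)))))
      wrap s (suc k) refl = trans (cong (_mod N) (lemma s k)) ([m+kn]mod (suc s) k)

  shift-perfect : ∀ m → (∀ a e → 0 < e → e < m → Transitive (shift a) (shift (a + e))) →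
                  PerfectSize m N
  shift-perfect m t = (λ a → shift-↔ (toℕ a)) , perfect
    where
    ordered : ∀ (a b : Fin m) → toℕ a < toℕ b → Transitive (shift (toℕ a)) (shift (toℕ b))
    ordered a b a<b =
      subst (λ b → Transitive (shift (toℕ a)) (shift b)) (m+[n∸m]≡n (<⇒≤ a<b))
        (t (toℕ a) (toℕ b ∸ toℕ a) (m<n⇒0<n∸m a<b)
          (≤-<-trans (m∸n≤m (toℕ b) (toℕ a)) (toℕ<n b)))

    perfect : ∀ (a b : Fin m) → ¬ (a ≡ b) → Transitive (shift (toℕ a)) (shift (toℕ b))
    perfect a b a≢b with <-cmp (toℕ a) (toℕ b)
    ... | tri< a<b _ _ = ordered a b a<b
    ... | tri≈ _ a≡b _ = contradiction (toℕ-injective a≡b) a≢b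
    ... | tri> _ _ b<a = Transitive-sym (ordered b a b<a)

-- Two basic sizes and their combinations.

module _ {m E : ℕ} (e∣E : ∀ e → 0 < e → e < m → e ∣ E) where

  PerfectSize-suc : PerfectSize m (suc E)
  PerfectSize-suc = shift-perfect m λ a e 0<e e<m → helper a e (e∣E e 0<e e<m)
    where
    helper : ∀ a e → e ∣ E → Transitive (shift a) (shift (a + e))
    helper a e (divides j E≡je) = shift-transitive⁻ a e j (sym E≡je)

  PerfectSize-pred : ∀ {n} → E ≡ suc (suc n) → PerfectSize m (suc n)
  PerfectSize-pred E≡2+n = shift-perfect m λ a e 0<e e<m → helper a e (e∣E e 0<e e<m)
    where
    helper : ∀ a e → e ∣ E → Transitive (shift a) (shift (a + e))
    helper a e (divides j E≡je) = shift-transitive⁺ a e j (trans (sym E≡je) E≡2+n)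

e∣m! : ∀ {m} e → 0 < e → e < m → e ∣ m !
e∣m! (suc e) _ e<m = ∣-trans (m∣m*n (e !)) (m≤n⇒m!∣n! (<⇒≤ e<m))

-- Write k = q d + r with r < d. As d² ≤ k gives r < d ≤ q, one can trade r of the q copies of d for
-- d + 1.
frobenius : ∀ d .{{_ : NonZero d}} k → d * d ≤ k → ∃ λ u → ∃ λ v → u * d + v * suc d ≡ k
frobenius d k dd≤k = k / d ∸ k % d , k % d , (begin
  (k / d ∸ k % d) * d + k % d * suc d             ≡⟨ lemma (k / d ∸ k % d) (k % d) d ⟩
  k % d + (k / d ∸ k % d + k % d) * d             ≡⟨ cong (λ q → k % d + q * d) (m∸n+n≡m r≤q) ⟩
  k % d + k / d * d                               ≡⟨ m≡m%n+[m/n]*n k d ⟨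
  k                                               ∎)
  where
  open ≡-Reasoning
  r≤q : k % d ≤ k / d
  r≤q = ≤-trans (<⇒≤ (m%n<n k d)) (subst (_≤ k / d) (m*n/n≡m d d) (/-monoˡ-≤ d dd≤k))
  lemma : ∀ u r d → u * d + r * suc d ≡ r + (u + r) * d
  lemma = solve-∀

PerfectSize-odd : ∀ m → ∃ λ b → 0 < b × (∀ k → b ≤ k → PerfectSize m (suc (2 * k)))
PerfectSize-odd m with m≤n⇒∃[o]m+o≡n (*-monoʳ-≤ 2 (1≤n! m))
... | o , 2+o≡2m! = d * d , s≤s z≤n , λ k dd≤k → combine k (frobenius d k dd≤k)
  where
  -- So `suc d` is 2 m! and E = `2 * suc d`. The outer 2 halves the even summands E - 2 and E to the
  -- consecutive `d` and `suc d`; the inner 2 keeps `d` positive when m! = 1.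
  d = suc o

  e∣2[1+d] : ∀ e → 0 < e → e < m → e ∣ 2 * suc d
  e∣2[1+d] e 0<e e<m = subst (λ h → e ∣ 2 * h) (sym 2+o≡2m!)
    (∣-trans (e∣m! e 0<e e<m) (∣-trans (n∣m*n 2) (n∣m*n 2)))

  small : PerfectSize m (suc (2 * d))
  small = PerfectSize-pred e∣2[1+d] (*-suc 2 d)

  large : PerfectSize m (suc (2 * suc d))
  large = PerfectSize-suc e∣2[1+d]

  lemma : ∀ u v d → u * (2 * d) + v * (2 * suc d) ≡ 2 * (u * d + v * suc d)
  lemma = solve-∀

  combine : ∀ k → (∃ λ u → ∃ λ v → u * d + v * suc d ≡ k) → PerfectSize m (suc (2 * k))
  combine k (u , v , eq) =
    subst (PerfectSize m ∘ suc) (trans (lemma u v d) (cong (2 *_) eq))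
      (glue (glue-replicate u small) (glue-replicate v large))

-- Return to Latin rectangles.

Star⇒Iter : ∀ {n} {P : Fin n → Fin n → Set} {x y} → Star P x y → Σ ℕ λ k → Iter P k x y
Star⇒Iter ε = zero , refl
Star⇒Iter (p ◅ ps) with Star⇒Iter ps
... | k , it = suc k , _ , p , it

-- A symbol repeated in a column would be a fixed point of a transitive step relation.
transitive⇒≢ : ∀ {n} {f g : C → Fin (suc (suc n))} → Injective _≡_ _≡_ f →
               Transitive f g → ∀ c → ¬ (f c ≡ g c)
transitive⇒≢ {f = f} {g} f-inj t c fc≡gc =
  case trans (fixed refl (t (f c) zero)) (sym (fixed refl (t (f c) (suc zero)))) of λ ()
  where
  fixed : ∀ {x y} → x ≡ f c → Star (Step f g) x y → y ≡ f c
  fixed x≡fc ε = x≡fc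
  fixed x≡fc ((c′ , fc′≡x , gc′≡z) ◅ ps) = fixed
    (trans (sym gc′≡z) (trans (cong g (f-inj (trans fc′≡x x≡fc))) (sym fc≡gc))) ps

PerfectSize⇒rectangle : ∀ {m n} → PerfectSize m (suc (suc n)) →
                        Σ (Array m (suc (suc n))) IsPerfectLatinRectangle
PerfectSize⇒rectangle (R , perfect) =
  (λ a → to (R a)) ,
  ((λ a → Bijection.bijective (↔⇒⤖ (R a))) , latin) ,
  λ a b a≢b x y → Star⇒Iter (perfect a b a≢b x y)
  where
  latin : ∀ c → Injective _≡_ _≡_ (λ a → to (R a) c)
  latin c {a} {b} eq with a ≟ b
  ... | yes a≡b = a≡b
  ... | no  a≢b =
    contradiction eq (transitive⇒≢ (Bijection.injective (↔⇒⤖ (R a))) (perfect a b a≢b) c)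

-- Positivity of `k` rules out size 1, where several rows would repeat the only symbol in its
-- column.
rectangle : ∀ {m} k → 0 < k → PerfectSize m (suc (2 * k)) →
            Σ (Array m (2 * k + 1)) IsPerfectLatinRectangle
rectangle {m} (suc k) _ P =
  subst (λ n → Σ (Array m n) IsPerfectLatinRectangle) (+-comm 1 (2 * suc k))
    (PerfectSize⇒rectangle P)

theorem1 : (m : ℕ) → 1 ≤ m →
    Σ ℕ λ n₀ → (k : ℕ) → n₀ ≤ 2 * k + 1 →
    Σ (Array m (2 * k + 1)) λ R → IsPerfectLatinRectangle R
theorem1 m _ =
  let b , 0<b , perfect = PerfectSize-odd m in
  2 * b + 1 , λ k n₀≤n →
    let b≤k = *-cancelˡ-≤ 2 (+-cancelʳ-≤ 1 (2 * b) (2 * k) n₀≤n)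
    in rectangle k (<-≤-trans 0<b b≤k) (perfect k b≤k)
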